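{- Let $G$ be a group and let $X$ be an infinite transitive $G$-space. Then each $G$-Ramsey ultrafilter on $X$ is $G$-selective.
   Context: A $G$-space is a set $X$ with an action $(g,x)\mapsto gx$ of the group $G$; it is transitive if for any $x,y\in X$ there exists $g\in G$ with $gx=y$. $[X]^2$ denotes the set of all $2$-element subsets of $X$. A coloring $\chi:[X]^2\to\{0,1\}$ is $G$-invariant if $\chi(\{x,y\})=\chi(\{gx,gy\})$ for all $\{x,y\}\in[X]^2$ and $g\in G$. An ultrafilter is free if it is non-principal. A free ultrafilter $\mathcal{U}$ on $X$ is $G$-Ramsey if, for every $G$-invariant coloring $\chi:[X]^2\to\{0,1\}$, there exists $U\in\mathcal{U}$ such that $\chi$ is constant on $[U]^2$. A partition $\mathcal{P}$ of $X$ is $G$-invariant if $gP\in\mathcal{P}$ for all $g\in G$ and $P\in\mathcal{P}$. A free ultrafilter $\mathcal{U}$ on $X$ is $G$-selective if, for every $G$-invariant partition $\mathcal{P}$ of $X$, either some cell of $\mathcal{P}$ is a member of $\mathcal{U}$, or there exists $U\in\mathcal{U}$ such that $|P\cap U|\leqslant 1$ for each $P\in\mathcal{P}$. -}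

module Defs where

open import Algebra.Bundles using (Group)
open import Data.Bool.Base using (Bool)
open import Data.Fin.Base using (Fin)
open import Data.Product using (∃; ∃-syntax; _×_; _,_)
open import Data.Sum.Base using (_⊎_; inj₁; inj₂)
open import Function.Base using (_∘_)
open import Function.Bundles using (Func; _↔_; _⇔_)
open import Level using (Level; _⊔_; suc)
open import Relation.Binary.Bundles using (Setoid)
open import Relation.Binary.Definitions using (_Respects_)
open import Relation.Binary.PropositionalEquality
  using (_≡_; _≢_; refl; sym; trans; cong; setoid)
open import Relation.Nullary.Negation using (¬_)
open import Relation.Unary
  using (Pred; _∈_; _⊆_; _≐_; _≬_; _∩_; ∁; Empty; Satisfiable)

private variable
  a c ℓ p u : Level

Infinite : Set a → Set a
Infinite X = ¬ (∃[ n ] (X ↔ Fin n))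

-- The set of subsets of X; subsets are compared by _≐_.
𝒫ow : Set a → Set (suc a)
𝒫ow {a} X = Pred X a

-- [ X ]² : an element {x , y} is a pair of distinct points, and pairs
-- differing only by a swap (or by the proof of x ≢ y) are equal.

record Pair (X : Set a) : Set a where
  constructor pair
  field
    fst      : X
    snd      : X
    distinct : fst ≢ snd

data _≈₂_ {X : Set a} : Pair X → Pair X → Set a where
  same : ∀ {x y x≢y x≢y′} → pair x y x≢y ≈₂ pair x y x≢y′
  swap : ∀ {x y x≢y y≢x} → pair x y x≢y ≈₂ pair y x y≢x

[_]² : Set a → Setoid a a
[ X ]² = record
  { Carrier = Pair X
  ; _≈_ = _≈₂_
  ; isEquivalence = record
    { refl = same
    ; sym = λ { same → same ; swap → swap }
    ; trans = λ { same same → same ; same swap → swap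
                ; swap same → swap ; swap swap → same }
    }
  }

Coloring : Set a → Set a
Coloring X = Func [ X ]² (setoid Bool)

ConstantOn : {X : Set a} → Coloring X → 𝒫ow X → Set a
ConstantOn χ U =
  ∃[ b ] (∀ x y x≢y → x ∈ U → y ∈ U → Func.to χ (pair x y x≢y) ≡ b)

record IsUltrafilter {X : Set a} (𝒰 : Pred (𝒫ow X) u) : Set (suc a ⊔ u) where
  field
    proper   : ∀ {A} → A ∈ 𝒰 → ¬ Empty A
    upward   : ∀ {A B} → A ⊆ B → A ∈ 𝒰 → B ∈ 𝒰
    ∩-closed : ∀ {A B} → A ∈ 𝒰 → B ∈ 𝒰 → (A ∩ B) ∈ 𝒰
    ultra    : ∀ A → A ∈ 𝒰 ⊎ ∁ A ∈ 𝒰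

Principal : {X : Set a} → Pred (𝒫ow X) u → Set (suc a ⊔ u)
Principal {X = X} 𝒰 = ∃[ x ] (∀ A → A ∈ 𝒰 ⇔ x ∈ A)

record IsFreeUltrafilter {X : Set a} (𝒰 : Pred (𝒫ow X) u) : Set (suc a ⊔ u) where
  field
    isUltrafilter : IsUltrafilter 𝒰
    nonPrincipal  : ¬ Principal 𝒰

record IsPartition {X : Set a} (𝒫 : Pred (𝒫ow X) p) : Set (suc a ⊔ p) where
  field
    respects : 𝒫 Respects _≐_
    nonempty : ∀ {P} → P ∈ 𝒫 → Satisfiable P
    disjoint : ∀ {P Q} → P ∈ 𝒫 → Q ∈ 𝒫 → P ≬ Q → P ≐ Q
    covers   : ∀ x → ∃[ P ] (P ∈ 𝒫 × x ∈ P)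

AtMostOne : {X : Set a} → 𝒫ow X → Set a
AtMostOne A = ∀ {x y} → x ∈ A → y ∈ A → x ≡ y

record GSpace (G : Group c ℓ) (a : Level) : Set (c ⊔ ℓ ⊔ suc a) where
  open Group G using (_≈_; _∙_; ε; _⁻¹; inverseˡ) renaming (Carrier to ∣G∣)
  infixr 7 _·_
  field
    Carrier    : Set a
    _·_        : ∣G∣ → Carrier → Carrier
    ·-cong     : ∀ {g h} x → g ≈ h → g · x ≡ h · x
    ·-identity : ∀ x → ε · x ≡ x
    ·-assoc    : ∀ g h x → (g ∙ h) · x ≡ g · (h · x)

  ·-cancel : ∀ g x → g ⁻¹ · (g · x) ≡ x
  ·-cancel g x =
    trans (sym (·-assoc (g ⁻¹) g x)) (trans (·-cong x (inverseˡ g)) (·-identity x))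

  ·-injective : ∀ g {x y} → g · x ≡ g · y → x ≡ y
  ·-injective g {x} {y} eq =
    trans (sym (·-cancel g x)) (trans (cong (g ⁻¹ ·_) eq) (·-cancel g y))

module _ {G : Group c ℓ} (X : GSpace G a) where
  open Group G using () renaming (Carrier to ∣G∣)
  open GSpace X using (_·_; ·-injective) renaming (Carrier to ∣X∣)

  Transitive : Set (c ⊔ a)
  Transitive = ∀ x y → ∃[ g ] g · x ≡ y

  _·₂_ : ∣G∣ → Pair ∣X∣ → Pair ∣X∣
  g ·₂ pair x y x≢y = pair (g · x) (g · y) (x≢y ∘ ·-injective g)

  InvariantColoring : Coloring ∣X∣ → Set (c ⊔ a)
  InvariantColoring χ = ∀ g e → Func.to χ e ≡ Func.to χ (g ·₂ e)

  image : ∣G∣ → 𝒫ow ∣X∣ → 𝒫ow ∣X∣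
  image g P y = ∃[ x ] (x ∈ P × y ≡ g · x)

  InvariantPartition : Pred (𝒫ow ∣X∣) p → Set (c ⊔ suc a ⊔ p)
  InvariantPartition 𝒫 =
    IsPartition 𝒫 × (∀ g {P} → P ∈ 𝒫 → image g P ∈ 𝒫)

  record IsRamsey (𝒰 : Pred (𝒫ow ∣X∣) u) : Set (c ⊔ suc a ⊔ u) where
    field
      isFreeUltrafilter : IsFreeUltrafilter 𝒰
      ramsey : ∀ χ → InvariantColoring χ → ∃[ U ] (U ∈ 𝒰 × ConstantOn χ U)

  -- p is the universe level of the families of subsets 𝒫 quantified over.
  record IsSelective (p : Level) (𝒰 : Pred (𝒫ow ∣X∣) u) :
                     Set (c ⊔ suc a ⊔ u ⊔ suc p) where
    field
      isFreeUltrafilter : IsFreeUltrafilter 𝒰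
      selective : (𝒫 : Pred (𝒫ow ∣X∣) p) → InvariantPartition 𝒫 →
        (∃[ P ] (P ∈ 𝒫 × P ∈ 𝒰)) ⊎
        (∃[ U ] (U ∈ 𝒰 × (∀ {P} → P ∈ 𝒫 → AtMostOne (P ∩ U))))

{-# OPTIONS --safe #-}
module Submission where

open import Defs
open import Algebra.Bundles using (Group)
open import Axiom.ExcludedMiddle using (ExcludedMiddle)
open import Data.Bool.Base using (true; false)
open import Data.Product using (∃-syntax; _×_; _,_)
open import Data.Sum.Base using (_⊎_; inj₁; inj₂)
open import Function.Bundles using (mk⇔)
open import Level using (Level; _⊔_; suc; Lift; lift; lower)
open import Relation.Binary.Core using (Rel)
open import Relation.Binary.Definitions using (Decidable; Symmetric)
open import Relation.Binary.PropositionalEquality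
  using (_≡_; refl; subst₂)
open import Relation.Nullary.Decidable
  using (Dec; yes; no; does; map′; does-⇔)
open import Relation.Nullary.Negation using (¬_; contradiction)
open import Relation.Unary using (Pred; _∈_; _⊆_; _∩_; Satisfiable)

-- An invariant partition colours a pair by whether its two points share a
-- cell.  A set of 𝒰 that is monochromatic for this invariant colouring either
-- lies in a single cell or meets every cell in at most one point.

private variable
  a c ℓ p r u : Level

-- Deciding `SameCell` takes excluded middle at the level of families of subsets, while equality of
-- points and inhabitation of a subset live at level `a`; this bridges the two.
lowerExcludedMiddle : ∀ b → ExcludedMiddle (a ⊔ b) → ExcludedMiddle a
lowerExcludedMiddle b em {A} = map′ lower lift (em {Lift b A})

SameCell : {X : Set a} → Pred (𝒫ow X) p → Rel X (suc a ⊔ p)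
SameCell 𝒫 x y = ∃[ P ] (P ∈ 𝒫 × x ∈ P × y ∈ P)

SameCell-sym : {X : Set a} (𝒫 : Pred (𝒫ow X) p) → Symmetric (SameCell 𝒫)
SameCell-sym 𝒫 (P , P∈𝒫 , x∈P , y∈P) = P , P∈𝒫 , y∈P , x∈P

-- The witnessing cell `Q` meets `P` at `x`, so disjointness of cells forces `Q` to coincide with
-- `P`.
SameCell⇒∈ : {X : Set a} {𝒫 : Pred (𝒫ow X) p} → IsPartition 𝒫 →
  ∀ {x y P} → P ∈ 𝒫 → x ∈ P → SameCell 𝒫 x y → y ∈ P
SameCell⇒∈ part {x} P∈𝒫 x∈P (Q , Q∈𝒫 , x∈Q , y∈Q)
  with Q⊆P , _ ← IsPartition.disjoint part Q∈𝒫 P∈𝒫 (x , x∈Q , x∈P) = Q⊆P y∈Q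

-- Symmetry is what makes the colour well defined on unordered pairs.
relationColoring : {X : Set a} {R : Rel X r} → Symmetric R → Decidable R → Coloring X
relationColoring R-sym R? = record
  { to   = λ { (pair x y _) → does (R? x y) }
  ; cong = λ { same → refl
             ; (swap {x} {y}) → does-⇔ (mk⇔ R-sym R-sym) (R? x y) (R? y x) }
  }

module _ {G : Group c ℓ} (X : GSpace G a) where
  open Group G using (_⁻¹)
  open GSpace X using (_·_; ·-cancel) renaming (Carrier to ∣X∣)

  SameCell-· : {𝒫 : Pred (𝒫ow ∣X∣) p} → InvariantPartition X 𝒫 →
    ∀ g {x y} → SameCell 𝒫 x y → SameCell 𝒫 (g · x) (g · y)
  SameCell-· (_ , invariant) g {x} {y} (P , P∈𝒫 , x∈P , y∈P) =
    image X g P , invariant g P∈𝒫 , (x , x∈P , refl) , (y , y∈P , refl)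

  relationColoring-invariant : {R : Rel ∣X∣ r} (R-sym : Symmetric R) (R? : Decidable R) →
    (∀ g {x y} → R x y → R (g · x) (g · y)) →
    InvariantColoring X (relationColoring R-sym R?)
  relationColoring-invariant {R = R} R-sym R? R-· g (pair x y _) =
    does-⇔ (mk⇔ (R-· g) R-·⁻¹) (R? x y) (R? (g · x) (g · y))
    where
    -- Preservation is assumed in one direction only; acting by `g ⁻¹` gives the converse.
    R-·⁻¹ : R (g · x) (g · y) → R x y
    R-·⁻¹ q = subst₂ R (·-cancel g x) (·-cancel g y) (R-· (g ⁻¹) q)

does≡true⇒ : {A : Set a} (A? : Dec A) → does A? ≡ true → A
does≡true⇒ (yes x) _ = x

does≡false⇒¬ : {A : Set a} (A? : Dec A) → does A? ≡ false → ¬ A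
does≡false⇒¬ (no ¬x) _ = ¬x

monochromatic⇒selective : {X : Set a} → ExcludedMiddle a →
  {𝒰 : Pred (𝒫ow X) u} → IsUltrafilter 𝒰 →
  {𝒫 : Pred (𝒫ow X) p} → IsPartition 𝒫 → (same? : Decidable (SameCell 𝒫)) →
  ∀ {U} → U ∈ 𝒰 → ConstantOn (relationColoring (SameCell-sym 𝒫) same?) U →
  (∃[ P ] (P ∈ 𝒫 × P ∈ 𝒰)) ⊎
  (∃[ V ] (V ∈ 𝒰 × (∀ {P} → P ∈ 𝒫 → AtMostOne (P ∩ V))))
monochromatic⇒selective em isU part same? {U} U∈𝒰 (true , const)
  -- `proper` only refutes emptiness of `U`; excluded middle turns this into a base point, whose
  -- cell is the one shown to be in `𝒰`.
  with em {Satisfiable U}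
... | no ¬sat = contradiction (λ x x∈U → ¬sat (x , x∈U)) (IsUltrafilter.proper isU U∈𝒰)
... | yes (x , x∈U)
  with P , P∈𝒫 , x∈P ← IsPartition.covers part x =
  inj₁ (P , P∈𝒫 , IsUltrafilter.upward isU U⊆P U∈𝒰)
  where
  U⊆P : U ⊆ P
  -- Colours exist only for pairs of distinct points, so the base point is treated apart.
  U⊆P {y} y∈U with em {x ≡ y}
  ... | yes refl = x∈P
  ... | no x≢y = SameCell⇒∈ part P∈𝒫 x∈P
    (does≡true⇒ (same? x y) (const x y x≢y x∈U y∈U))
monochromatic⇒selective em isU {𝒫} part same? {U} U∈𝒰 (false , const) =
  inj₂ (U , U∈𝒰 , atMostOne)
  where
  atMostOne : ∀ {P} → P ∈ 𝒫 → AtMostOne (P ∩ U)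
  atMostOne {P} P∈𝒫 {x} {y} (x∈P , x∈U) (y∈P , y∈U) with em {x ≡ y}
  ... | yes x≡y = x≡y
  -- `P` itself would be a common cell of two distinct points of `U`, which the colour `false` rules
  -- out.
  ... | no x≢y = contradiction (P , P∈𝒫 , x∈P , y∈P)
    (does≡false⇒¬ (same? x y) (const x y x≢y x∈U y∈U))

theorem4 : ∀ {c ℓ a u p : Level} → ExcludedMiddle (suc a ⊔ p) →
    (G : Group c ℓ) (X : GSpace G a) →
    Infinite (GSpace.Carrier X) → Transitive X →
    (𝒰 : Pred (𝒫ow (GSpace.Carrier X)) u) →
    IsRamsey X 𝒰 → IsSelective X p 𝒰
theorem4 {a = a} {p = p} em G X _ _ 𝒰 isRamsey = record
  { isFreeUltrafilter = isFreeUltrafilter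
  ; selective = λ 𝒫 inv@(part , _) →
      -- The partition is arbitrary, so the colour of a pair is chosen classically.
      let same? : Decidable (SameCell 𝒫)
          same? _ _ = em
          U , U∈𝒰 , const = ramsey
            (relationColoring (SameCell-sym 𝒫) same?)
            (relationColoring-invariant X (SameCell-sym 𝒫) same? (SameCell-· X inv))
      in monochromatic⇒selective (lowerExcludedMiddle (suc a ⊔ p) em)
           isUltrafilter part same? U∈𝒰 const
  }
  where
  open IsRamsey isRamsey
  open IsFreeUltrafilter isFreeUltrafilter
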